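{- Let $G$ be a finitely generated abelian group, written as \[ G=\Big(\bigoplus_{i=1}^{m_1}\mathbb{Z}/(2n_i+1)\mathbb{Z}\Big)\oplus\Big(\bigoplus_{i=1}^{m_2}\mathbb{Z}/2\mathbb{Z}\Big)\oplus\Big(\bigoplus_{i=1}^{m_3}\mathbb{Z}/(4q_i)\mathbb{Z}\Big)\oplus\Big(\bigoplus_{i=1}^{r}\mathbb{Z}\Big), \] with $n_i,q_i$ positive integers and $m_1,m_2,m_3,r\ge 0$. Then the maximal size $m$ of an avoidable subset of $G$ containing an even element is: (a) $1+2^{m_2-1}$, if $m_1=m_3=r=0$; (b) $2$, if $m_2=m_3=r=0$; (c) $2+2^{m_2-1}$, if $m_3=r=0$ and $m_2\neq 0$; (d) $2+2^{m_2}$ otherwise.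
   Context: For a set $S$ with a binary operation, a subset $U\subseteq S$ is avoidable if there is a partition $\{A,B\}$ of $S$ such that no element of $U$ is the product (here: sum) of two distinct elements of $A$ or of two distinct elements of $B$. In an abelian group written additively, an element $b$ is even if there exists $x$ with $2x=b$, and odd otherwise.
   Formalization: The trivial group (m_1=m_2=m_3=r=0) is excluded, since (a) would give 1+2^{ -1} there, and cases (a)–(d) are read in order, so that (c) requires m_1≠0 (otherwise it contradicts (a), e.g. for Z/2Z). -}

module Defs where

open import Data.Nat using (ℕ; zero; suc; _≤_; _^_; _∸_) renaming (_+_ to _+ℕ_; _*_ to _*ℕ_)
open import Data.Integer using (ℤ; +_) renaming (_+_ to _+ℤ_; _-_ to _-ℤ_)
open import Data.Integer.Divisibility using (_∣_)
open import Data.Fin using (Fin)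
open import Data.Bool using (Bool; true; false)
open import Data.List using (List; length)
open import Data.List.Relation.Unary.Any using (Any)
open import Data.List.Relation.Unary.All using (All)
open import Data.List.Relation.Unary.AllPairs using (AllPairs)
open import Data.Product using (Σ; ∃; _×_; _,_)
open import Relation.Binary.PropositionalEquality using (_≡_)
open import Relation.Nullary using (¬_)

-- x ≡ y (mod k) in ℤ ; for k = 0 this is equality
_≡_[mod_] : ℤ → ℤ → ℕ → Set
x ≡ y [mod k ] = (+ k) ∣ (x -ℤ y)

-- The group
--   G = ⊕_{i<m1} ℤ/(2 n_i + 1) ⊕ ⊕_{i<m2} ℤ/2 ⊕ ⊕_{i<m3} ℤ/(4 q_i) ⊕ ℤ^r
-- Elements are tuples of integer representatives; equality is the
-- componentwise congruence relation _≈_ (a setoid presentation of G).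
module Group (m1 m2 m3 r : ℕ) (n : Fin m1 → ℕ) (q : Fin m3 → ℕ) where

  record G : Set where
    constructor ⟨_,_,_,_⟩
    field
      odd-part  : Fin m1 → ℤ
      two-part  : Fin m2 → ℤ
      four-part : Fin m3 → ℤ
      free-part : Fin r  → ℤ
  open G public

  infix 4 _≈_
  _≈_ : G → G → Set
  x ≈ y = (∀ i → odd-part x i ≡ odd-part y i [mod (2 *ℕ n i +ℕ 1) ])
        × (∀ i → two-part x i ≡ two-part y i [mod 2 ])
        × (∀ i → four-part x i ≡ four-part y i [mod (4 *ℕ q i) ])
        × (∀ i → free-part x i ≡ free-part y i)

  infixl 6 _⊕_
  _⊕_ : G → G → G
  x ⊕ y = ⟨ (λ i → odd-part x i +ℤ odd-part y i)
          , (λ i → two-part x i +ℤ two-part y i)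
          , (λ i → four-part x i +ℤ four-part y i)
          , (λ i → free-part x i +ℤ free-part y i) ⟩

  Even : G → Set
  Even b = ∃ λ x → x ⊕ x ≈ b

  -- U ⊆ G is avoidable: there is a partition {A , B} of G (given by a
  -- colouring well-defined on G, with both classes nonempty) such that no
  -- element of U is the sum of two distinct elements of the same class.
  Avoidable : (G → Set) → Set
  Avoidable U = Σ (G → Bool) λ col →
      (∀ x y → x ≈ y → col x ≡ col y)
    × (∃ λ a → col a ≡ true) × (∃ λ b → col b ≡ false)
    × (∀ u x y → U u → ¬ (x ≈ y) → col x ≡ col y → ¬ (x ⊕ y ≈ u))

  -- finite subsets of G given by lists of pairwise distinct elements
  Distinct : List G → Set
  Distinct = AllPairs (λ x y → ¬ (x ≈ y))

  _∈G_ : G → List G → Set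
  g ∈G xs = Any (λ y → g ≈ y) xs

  ContainsEven : (G → Set) → Set
  ContainsEven U = ∃ λ e → U e × Even e

  IsMaxAvoidableEvenSize : ℕ → Set₁
  IsMaxAvoidableEvenSize m =
      (Σ (List G) λ xs → length xs ≡ m × Distinct xs
         × Avoidable (_∈G xs) × ContainsEven (_∈G xs))
    × (∀ (U : G → Set) → Avoidable U → ContainsEven U →
         ∀ (xs : List G) → All U xs → Distinct xs → length xs ≤ m)

-- The value in Theorem 2.6, cases (a)-(d) read in order (first match).
maxSize : ℕ → ℕ → ℕ → ℕ → ℕ
maxSize m1 m2 (suc _) r = 2 +ℕ 2 ^ m2
maxSize m1 m2 zero (suc _) = 2 +ℕ 2 ^ m2
maxSize zero m2 zero zero = 1 +ℕ 2 ^ (m2 ∸ 1)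
maxSize (suc _) zero zero zero = 2
maxSize (suc _) (suc k) zero zero = 2 +ℕ 2 ^ k

{-# OPTIONS --safe #-}

-- A coloring avoids U iff, for every u in U, it separates x from u - x unless these coincide.
-- For u + v + w = 2s the points s - u, s - v, s - w would form a triangle, so U has no three
-- distinct elements with even sum, hence at most two even ones. A 5-cycle shows that any two
-- odd elements u, v have 2u = 2v; as u + v is odd, they differ in the ℤ/2 coordinates, which
-- leaves at most 2^m₂ odd elements. If m₃ = r = 0, the translate of the odd part by one of its
-- elements is moreover disjoint from it modulo 2G, which halves this bound.
-- Conversely, let o be a generator of a summand ℤ or ℤ/4q (of ℤ/(2n+1) × ℤ/2 if m₃ = r = 0).
-- Then {0, 2o} ∪ (o + the remaining ℤ/2 coordinates) is avoided when x is colored by the half of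
-- its cyclic summand in which its first coordinate that is not self-inverse lies, the coordinate
-- of o coming last. If only ℤ/2 summands occur then 2o = 0; if G has odd order, {0, o} is used.

module Submission where

open import Defs
open import Data.Nat using (ℕ; zero; suc; _≤_; _<_; _^_; z≤n; s≤s; s≤s⁻¹; NonZero)
import Data.Nat as ℕ
import Data.Nat.Properties as ℕ
import Data.Nat.Divisibility as ℕ
open import Data.Integer using (ℤ; +_; -[1+_]; _+_; _*_; -_; _-_; 0ℤ; 1ℤ)
import Data.Integer.Properties as ℤ
open import Data.Integer.DivMod using (_%ℕ_; _/ℕ_; n%ℕd<d; a≡a%ℕn+[a/ℕn]*n)
open import Data.Integer.Divisibility.Signed
open import Data.Integer.Tactic.RingSolver using (solve-∀)
open import Data.Fin using (Fin; toℕ; fromℕ<; combine; finToFun; funToFin)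
open import Data.Fin.Properties using (funToFin-finToFin; finToFun-funToFin; injective⇒≤; toℕ-injective; toℕ<n; fromℕ<-injective; all?)
open import Data.List using (List; []; _∷_; length; filter; tabulate; map; _++_; allFin; lookup)
open import Data.List.Properties using (length-tabulate; length-map; length-++)
open import Data.List.Membership.Propositional using (_∈_; find)
open import Data.List.Membership.Propositional.Properties using (∈-filter⁺; ∈-filter⁻; ∈-tabulate⁺; ∈-++⁺ˡ; ∈-++⁺ʳ; ∈-map⁺; ∈-allFin; ∈-lookup)
open import Data.List.Relation.Unary.Any using (here; there)
import Data.List.Relation.Unary.Any as Any
import Data.List.Relation.Unary.Any.Properties as Any
open import Data.List.Relation.Unary.All using (All; []; _∷_)
import Data.List.Relation.Unary.All as All
import Data.List.Relation.Unary.All.Properties as All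
open import Data.List.Relation.Unary.AllPairs using (AllPairs; []; _∷_)
import Data.List.Relation.Unary.AllPairs as AllPairs
import Data.List.Relation.Unary.AllPairs.Properties as AllPairs
import Data.Bool as Bool
open import Data.Bool using (Bool; true; false; not; T)
open import Data.Bool.Properties using (T?; ¬-not; not-involutive)
open import Data.Product using (∃; _×_; _,_; proj₁; proj₂)
open import Data.Sum using (_⊎_; inj₁; inj₂)
open import Data.Empty using (⊥)
open import Function using (_∘_)
open import Relation.Binary using (tri<; tri≈; tri>)
open import Relation.Binary.PropositionalEquality
open import Relation.Nullary using (¬_; Dec; yes; no; does; contradiction; _×-dec_)
open import Relation.Nullary.Decidable using (dec-true; dec-false; ¬?; map′)

-- Divisibility in ℤ

∣-resp : ∀ {m a b} → a ≡ b → m ∣ a → m ∣ b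
∣-resp = subst (_ ∣_)

-- The equation that matches the sum to its target is a parameter, so that each use reduces to an
-- identity for the ring solver.
∣-sum : ∀ {m a b c} → a + b ≡ c → m ∣ a → m ∣ b → m ∣ c
∣-sum eq m∣a m∣b = ∣-resp eq (∣m∣n⇒∣m+n m∣a m∣b)

∣-diff : ∀ {m a b c} → a - b ≡ c → m ∣ a → m ∣ b → m ∣ c
∣-diff eq m∣a m∣b = ∣-resp eq (∣m∣n⇒∣m-n m∣a m∣b)

∣-refl⁰ : ∀ {m} a → m ∣ a - a
∣-refl⁰ a = divides 0ℤ (ℤ.+-inverseʳ a)

-- Halves of cyclic groups and the reflections that swap them

halfℕ : ℕ → ℕ → Bool
halfℕ N a = does ((1 ℕ.≤? a) ×-dec (a ℕ.+ a ℕ.≤? N))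

-- The modulus 0 stands for ℤ, with the positive integers as half. Leaving out 0 and keeping N/2
-- lets both reflections k ↦ -k and k ↦ 1 - k swap the classes away from their fixed points.
half : ℕ → ℤ → Bool
half zero      (+ suc _) = true
half zero      _         = false
half N@(suc _) k         = halfℕ N (k %ℕ N)

-- A sum `α` ≤ 1 leaves only the pair 0, 1. For the sum α + N, the inequalities 0 < a and 2a ≤ N <
-- 2b place `a` in the half and `b` outside.
halfℕ-flip-< : ∀ {N α a b} → α ≤ 1 → a < b → b < N →
  (a ℕ.+ b ≡ α) ⊎ (a ℕ.+ b ≡ α ℕ.+ N) → halfℕ N a ≢ halfℕ N b
halfℕ-flip-< {N} {a = zero} {suc zero} _ _ 1<N (inj₁ _) eq =
  contradiction (trans eq (dec-true ((1 ℕ.≤? 1) ×-dec (2 ℕ.≤? N)) (s≤s z≤n , 1<N))) λ ()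
halfℕ-flip-< {a = zero} {suc (suc b)} α≤1 _ _ (inj₁ refl) _ = contradiction α≤1 λ { (s≤s ()) }
halfℕ-flip-< {a = suc a} {suc b} α≤1 _ _ (inj₁ refl) _
  rewrite ℕ.+-suc a b = contradiction α≤1 λ { (s≤s ()) }
halfℕ-flip-< {N} {α} {a} {b} α≤1 a<b b<N (inj₂ eq) h = contradiction
  (trans (sym (dec-true ((1 ℕ.≤? a) ×-dec (a ℕ.+ a ℕ.≤? N)) (0<a , 2a≤N)))
    (trans h (dec-false ((1 ℕ.≤? b) ×-dec (b ℕ.+ b ℕ.≤? N)) (λ (_ , 2b≤N) → ℕ.<⇒≱ N<2b 2b≤N))))
  λ ()
  where
  open ℕ.≤-Reasoning
  0<a : 0 < a
  0<a = ℕ.+-cancelʳ-< b 0 a (begin-strict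
    b <⟨ b<N ⟩ N ≤⟨ ℕ.m≤n+m N α ⟩ α ℕ.+ N ≡⟨ eq ⟨ a ℕ.+ b ∎)
  -- From a < b follows 2a < a + b ≤ N + 1, and strictness absorbs the extra 1.
  2a≤N : a ℕ.+ a ≤ N
  2a≤N = s≤s⁻¹ (begin-strict
    a ℕ.+ a <⟨ ℕ.+-monoʳ-< a a<b ⟩ a ℕ.+ b ≡⟨ eq ⟩ α ℕ.+ N ≤⟨ ℕ.+-monoˡ-≤ N α≤1 ⟩ suc N ∎)
  N<2b : N < b ℕ.+ b
  N<2b = begin-strict
    N ≤⟨ ℕ.m≤n+m N α ⟩ α ℕ.+ N ≡⟨ eq ⟨ a ℕ.+ b <⟨ ℕ.+-monoˡ-< b a<b ⟩ b ℕ.+ b ∎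

-- Since a + b < 2N, the quotient of a + b - α by `N` is at most 1. A negative quotient forces N = α
-- = 1 and a = b = 0, whence the alternative `a ≡ b`.
residues-sum : ∀ {N α a b} → α ≤ 1 → a < N → b < N → + N ∣ + (a ℕ.+ b) - + α →
  a ≡ b ⊎ (a ℕ.+ b ≡ α) ⊎ (a ℕ.+ b ≡ α ℕ.+ N)
residues-sum {N} {α} {a} {b} α≤1 a<N b<N (divides q eq) = go q (trans (shift (+ (a ℕ.+ b)) (+ α)) (cong (_+ + α) eq))
  where
  shift : ∀ s t → s ≡ s - t + t
  shift = solve-∀
  go : ∀ q → + (a ℕ.+ b) ≡ q * + N + + α → a ≡ b ⊎ (a ℕ.+ b ≡ α) ⊎ (a ℕ.+ b ≡ α ℕ.+ N)
  go (+ zero) e = inj₂ (inj₁ (ℤ.+-injective e))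
  go (+ suc zero) e = inj₂ (inj₂ (trans (ℤ.+-injective (trans e (cong (_+ + α) (ℤ.*-identityˡ (+ N))))) (ℕ.+-comm N α)))
  go (+ suc (suc q)) e = contradiction (ℕ.+-mono-< a<N b<N) (ℕ.≤⇒≯ (begin
    N ℕ.+ N                       ≤⟨ ℕ.+-monoʳ-≤ N (ℕ.m≤m+n N (q ℕ.* N)) ⟩
    suc (suc q) ℕ.* N             ≤⟨ ℕ.m≤m+n _ α ⟩
    suc (suc q) ℕ.* N ℕ.+ α       ≡⟨ ℤ.+-injective (trans e (cong (_+ + α) (sym (ℤ.pos-* (suc (suc q)) N)))) ⟨
    a ℕ.+ b ∎))
    where open ℕ.≤-Reasoning
  go -[1+ q ] e = inj₁ (trans (ℕ.m+n≡0⇒m≡0 a s≡0) (sym (ℕ.m+n≡0⇒n≡0 a s≡0)))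
    where
    open ℕ.≤-Reasoning
    neg : ∀ q n t → (- q * n + t) + q * n ≡ t
    neg = solve-∀
    total : a ℕ.+ b ℕ.+ suc q ℕ.* N ≡ α
    total = ℤ.+-injective (trans (cong₂ _+_ e (ℤ.pos-* (suc q) N)) (neg (+ suc q) (+ N) (+ α)))
    s≡0 : a ℕ.+ b ≡ 0
    s≡0 = ℕ.n≤0⇒n≡0 (ℕ.+-cancelʳ-≤ 1 _ _ (begin
      a ℕ.+ b ℕ.+ 1 ≤⟨ ℕ.+-monoʳ-≤ (a ℕ.+ b) (ℕ.≤-trans (ℕ.≤-<-trans z≤n a<N) (ℕ.m≤m+n N (q ℕ.* N))) ⟩
      a ℕ.+ b ℕ.+ suc q ℕ.* N ≡⟨ total ⟩
      α ≤⟨ α≤1 ⟩ 1 ∎))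

residues-unique : ∀ {N a b} → a < N → b < N → + N ∣ + a - + b → a ≡ b
residues-unique {N} {a} {b} a<N b<N (divides q eq) = go q eq
  where
  go : ∀ q → + a - + b ≡ q * + N → a ≡ b
  go (+ zero) e = ℤ.+-injective (ℤ.i-j≡0⇒i≡j (+ a) (+ b) e)
  go (+ suc q) e = contradiction a<N (ℕ.≤⇒≯ (ℕ.≤-trans (ℕ.m≤m+n N (q ℕ.* N)) (ℕ.≤-trans (ℕ.m≤m+n _ b)
    (ℕ.≤-reflexive (ℤ.+-injective (trans (cong (_+ + b) (trans (ℤ.pos-* (suc q) N) (sym e))) (shift (+ a) (+ b))))))))
    where
    shift : ∀ s t → s - t + t ≡ s
    shift = solve-∀
  go -[1+ q ] e = contradiction b<N (ℕ.≤⇒≯ (ℕ.≤-trans (ℕ.m≤m+n N (q ℕ.* N)) (ℕ.≤-trans (ℕ.m≤m+n _ a)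
    (ℕ.≤-reflexive (ℤ.+-injective (trans (cong₂ _+_ (trans (ℤ.pos-* (suc q) N) (trans (neg (+ suc q) (+ N)) (cong -_ (sym e)))) refl) (shift (+ a) (+ b))))))))
    where
    neg : ∀ s t → s * t ≡ - (- s * t)
    neg = solve-∀
    shift : ∀ s t → - (s - t) + s ≡ t
    shift = solve-∀

∣-residue : ∀ k N .{{_ : NonZero N}} → + N ∣ k - + (k %ℕ N)
∣-residue k N = divides (k /ℕ N) (trans (cong (_- + (k %ℕ N)) (a≡a%ℕn+[a/ℕn]*n k N)) (cancel (+ (k %ℕ N)) _))
  where
  cancel : ∀ s t → (s + t) - s ≡ t
  cancel = solve-∀

half-cong : ∀ N {j k} → + N ∣ j - k → half N j ≡ half N k
half-cong zero {j} {k} N∣j-k = cong (half zero) (ℤ.i-j≡0⇒i≡j j k (0∣⇒≡0 N∣j-k))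
half-cong N@(suc _) {j} {k} N∣j-k = cong (halfℕ N) (residues-unique (n%ℕd<d j N) (n%ℕd<d k N)
  (∣-diff (rearrange j k _ _) N∣j-k (∣m∣n⇒∣m-n (∣-residue j N) (∣-residue k N))))
  where
  rearrange : ∀ j k a b → (j - k) - ((j - a) - (k - b)) ≡ a - b
  rearrange = solve-∀

-- For positive `N` this reduces to `halfℕ-flip-<` on residues. In ℤ, two positive integers have sum
-- at least 2, and two others reach a sum ≥ 0 only if both vanish.
half-flip : ∀ N α {j k} → α ≤ 1 → + N ∣ j + k - + α → ¬ (+ N ∣ j - k) → half N j ≢ half N k
half-flip zero α {j} {k} α≤1 0∣ j≢k = go j k α≤1 (ℤ.i-j≡0⇒i≡j (j + k) (+ α) (0∣⇒≡0 0∣)) j≢k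
  where
  go : ∀ {α} j k → α ≤ 1 → j + k ≡ + α → ¬ (0ℤ ∣ j - k) → half zero j ≢ half zero k
  go (+ zero) (+ zero) _ _ j≢k _ = j≢k (divides 0ℤ refl)
  go (+ suc a) (+ suc b) α≤1 refl _ _ rewrite ℕ.+-suc a b = contradiction α≤1 λ { (s≤s ()) }
  go (+ suc a) (+ zero) _ _ _ ()
  go (+ suc a) -[1+ b ] _ _ _ ()
  go (+ zero) (+ suc b) _ _ _ ()
  go -[1+ a ] (+ suc b) _ _ _ ()
half-flip N@(suc _) α {j} {k} α≤1 N∣ j≢k eq =
  go (residues-sum α≤1 a<N b<N (∣-diff (rearrange j k (+ α) _ _) N∣ (∣m∣n⇒∣m+n (∣-residue j N) (∣-residue k N))))
  where
  a = j %ℕ N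
  b = k %ℕ N
  a<N = n%ℕd<d j N
  b<N = n%ℕd<d k N
  rearrange : ∀ j k t a b → (j + k - t) - ((j - a) + (k - b)) ≡ (a + b) - t
  rearrange = solve-∀
  back : ∀ j k a b → ((j - a) - (k - b)) + (a - b) ≡ j - k
  back = solve-∀
  a≢b : a ≢ b
  a≢b a≡b = j≢k (∣-sum (back j k (+ a) (+ b)) (∣m∣n⇒∣m-n (∣-residue j N) (∣-residue k N))
    (∣-resp (cong (λ c → + a - + c) a≡b) (∣-refl⁰ (+ a))))
  go : a ≡ b ⊎ (a ℕ.+ b ≡ α) ⊎ (a ℕ.+ b ≡ α ℕ.+ N) → ⊥
  go (inj₁ a≡b) = a≢b a≡b
  go (inj₂ s) with ℕ.<-cmp a b
  ... | tri< a<b _ _ = halfℕ-flip-< α≤1 a<b b<N s eq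
  ... | tri≈ _ a≡b _ = a≢b a≡b
  ... | tri> _ _ b<a = halfℕ-flip-< α≤1 b<a a<N
    (subst (λ t → t ≡ α ⊎ t ≡ α ℕ.+ N) (ℕ.+-comm a b) s) (sym eq)


even∤1 : ¬ (+ 2 ∣ 1ℤ)
even∤1 2∣1 with () ← ℕ.∣1⇒≡1 (∣⇒∣ᵤ 2∣1)

-- For an even modulus k ↦ 1 - k changes parity, so there are no fixed points to exclude.
half-flip-odd-sum : ∀ N {j k} → + 2 ∣ + N → + N ∣ j + k - 1ℤ → half N j ≢ half N k
half-flip-odd-sum N {j} {k} 2∣N N∣ = half-flip N 1 {j} {k} (s≤s z≤n) N∣ λ N∣j-k →
  even∤1 (∣-diff (double j k) (∣m⇒∣m*n j ∣-refl) (∣-sum refl (∣-trans 2∣N N∣) (∣-trans 2∣N N∣j-k)))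
  where
  double : ∀ j k → + 2 * j - ((j + k - 1ℤ) + (j - k)) ≡ 1ℤ
  double = solve-∀

-- With two colors an odd number of changes is a change. This rules out closed walks of length 3
-- and, nested, of length 5.
flip₃ : ∀ {a b c d : Bool} → a ≢ b → b ≢ c → c ≢ d → a ≢ d
flip₃ a≢b b≢c c≢d a≡d = c≢d (trans (sym (trans (¬-not a≢b) (trans (cong not (¬-not b≢c)) (not-involutive _)))) a≡d)

-- Composes the reflections j ↦ 1 - j ↦ j - 1 ↦ 2 - j.
half-flip-two-sum : ∀ N {j k} → + 2 ∣ + N → + N ∣ j + k - + 2 → ¬ (+ N ∣ j - k) → half N j ≢ half N k
half-flip-two-sum N {j} {k} 2∣N N∣ j≢k = flip₃ {half N j} {half N (1ℤ - j)} {half N (j - 1ℤ)}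
  (half-flip-odd-sum N 2∣N (divides 0ℤ (e₁ j)))
  -- The middle reflection fixes 1 - j only if 2j ≡ 2, which with j + k ≡ 2 means j ≡ k.
  (half-flip N 0 z≤n (divides 0ℤ (e₂ j)) (λ h → j≢k (∣-diff (e₃ j k) (∣m⇒∣-m N∣) h)))
  (half-flip-odd-sum N 2∣N (∣-resp (e₄ j k) N∣))
  where
  e₁ : ∀ j → j + (1ℤ - j) - 1ℤ ≡ 0ℤ
  e₁ = solve-∀
  e₂ : ∀ j → (1ℤ - j) + (j - 1ℤ) - 0ℤ ≡ 0ℤ
  e₂ = solve-∀
  e₃ : ∀ j k → - (j + k - + 2) - ((1ℤ - j) - (j - 1ℤ)) ≡ j - k
  e₃ = solve-∀
  e₄ : ∀ j k → j + k - + 2 ≡ (j - 1ℤ) + k - 1ℤ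
  e₄ = solve-∀

-- Products of cyclic groups, parity and closed walks

module Congruences {I : Set} (N : I → ℕ) where

  infix 4 _≋_
  infixl 6 _⊞_

  -- Divisibility by 0 is equality to 0, so a modulus 0 encodes a summand ℤ and all summands are
  -- treated alike.
  _≋_ : (I → ℤ) → (I → ℤ) → Set
  x ≋ y = ∀ i → + N i ∣ x i - y i

  _⊞_ : (I → ℤ) → (I → ℤ) → I → ℤ
  (x ⊞ y) i = x i + y i

  ≋-sym : ∀ x y → x ≋ y → y ≋ x
  ≋-sym x y x≋y i = ∣-resp (swap (x i) (y i)) (∣m⇒∣-m (x≋y i))
    where
    swap : ∀ a b → - (a - b) ≡ b - a
    swap = solve-∀

  -- Avoidance of the single element `u`, so that one coloring can be tested against a list element
  -- by element.
  FlipsAt : ((I → ℤ) → Bool) → (I → ℤ) → Set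
  FlipsAt c u = ∀ x y → ¬ x ≋ y → x ⊞ y ≋ u → c x ≢ c y

  IsEven : (I → ℤ) → Set
  IsEven x = ∃ λ h → h ⊞ h ≋ x

  -- Evenness depends only on the class modulo 2G; the closure properties below are instances with a
  -- suitable `h`.
  even-shift : ∀ {x y} (h : I → ℤ) → (∀ i → + N i ∣ x i + (h i + h i) - y i) → IsEven x → IsEven y
  even-shift {x} {y} h d (g , g+g≋x) = (λ i → g i + h i) ,
    λ i → ∣-sum (collect (g i) (h i) (x i) (y i)) (g+g≋x i) (d i)
    where
    collect : ∀ g h x y → (g + g - x) + (x + (h + h) - y) ≡ (g + h) + (g + h) - y
    collect = solve-∀

  even-resp : ∀ {x y} → x ≋ y → IsEven x → IsEven y
  even-resp {x} {y} x≋y = even-shift (λ _ → 0ℤ) λ i → ∣-resp (pad (x i) (y i)) (x≋y i)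
    where
    pad : ∀ a b → a - b ≡ a + (0ℤ + 0ℤ) - b
    pad = solve-∀

  even-⊞ : ∀ {x y} → IsEven x → IsEven y → IsEven (x ⊞ y)
  even-⊞ {x} {y} ex (h , h+h≋y) = even-shift h (λ i → ∣-resp (pad (h i) (x i) (y i)) (h+h≋y i)) ex
    where
    pad : ∀ h a b → h + h - b ≡ a + (h + h) - (a + b)
    pad = solve-∀

  even-⊞-cancelʳ : ∀ {x y} → IsEven (x ⊞ y) → IsEven y → IsEven x
  even-⊞-cancelʳ {x} {y} ex+y (h , h+h≋y) =
    even-shift (λ i → - h i) (λ i → ∣-resp (pad (h i) (x i) (y i)) (∣m⇒∣-m (h+h≋y i))) ex+y
    where
    pad : ∀ h a b → - (h + h - b) ≡ (a + b) + (- h + - h) - a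
    pad = solve-∀

  -- As 2s = u + v + w, any two of the points s - u, s - v, s - w sum to one of `u`, `v`, `w`, and
  -- they coincide only if two of `u`, `v`, `w` do.
  no-even-triple : ∀ {c u v w} → FlipsAt c u → FlipsAt c v → FlipsAt c w →
    ¬ u ≋ v → ¬ v ≋ w → ¬ u ≋ w → ¬ IsEven (u ⊞ v ⊞ w)
  no-even-triple {c} {u} {v} {w} fu fv fw u≉v v≉w u≉w (s , s+s≋) =
    flip₃ {c x} {c y} {c z} {c x}
      (fu x y (λ h → v≉w (λ i → ∣-resp (e₁ (s i) (v i) (w i)) (∣m⇒∣-m (h i))))
        (λ i → ∣-resp (e₂ (s i) (u i) (v i) (w i)) (s+s≋ i)))
      (fv y z (λ h → u≉w (λ i → ∣-resp (e₃ (s i) (u i) (w i)) (h i)))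
        (λ i → ∣-resp (e₄ (s i) (u i) (v i) (w i)) (s+s≋ i)))
      (fw z x (λ h → u≉v (λ i → ∣-resp (e₁ (s i) (u i) (v i)) (∣m⇒∣-m (h i))))
        (λ i → ∣-resp (e₅ (s i) (u i) (v i) (w i)) (s+s≋ i)))
      refl
    where
    x y z : I → ℤ
    x i = s i - v i
    y i = s i - w i
    z i = s i - u i
    e₁ : ∀ s a b → - ((s - a) - (s - b)) ≡ a - b
    e₁ = solve-∀
    e₂ : ∀ s u v w → s + s - (u + v + w) ≡ (s - v) + (s - w) - u
    e₂ = solve-∀
    e₃ : ∀ s u w → (s - w) - (s - u) ≡ u - w
    e₃ = solve-∀
    e₄ : ∀ s u v w → s + s - (u + v + w) ≡ (s - w) + (s - u) - v
    e₄ = solve-∀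
    e₅ : ∀ s u v w → s + s - (u + v + w) ≡ (s - u) + (s - v) - w
    e₅ = solve-∀

  -- With t + t ≋ e, the reflections in u, v, u, v, e lead from u - v + t through
  -- v - t, t, u - t and v - u + t back to the start, a closed walk of length 5.
  odd-doubles-agree : ∀ {c u v e} → FlipsAt c u → FlipsAt c v → FlipsAt c e →
    IsEven e → ¬ IsEven u → ¬ IsEven v → ¬ ¬ (u ⊞ u ≋ v ⊞ v)
  odd-doubles-agree {c} {u} {v} {e} fu fv fe (t , t+t≋e) u-odd v-odd 2u≉2v =
    flip₃ {c x₀} {c x₃} {c x₄} {c x₀}
      (flip₃ {c x₀} {c x₁} {c t} {c x₃}
        -- In each of the first four steps, equal endpoints would exhibit `u` or `v` as a double.
        (fu x₀ x₁ (λ h → u-odd ((λ i → v i - t i) ,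
            λ i → ∣-resp (e₁ (t i) (u i) (v i)) (∣m⇒∣-m (h i))))
          (λ i → divides 0ℤ (s₁ (t i) (u i) (v i))))
        (fv x₁ t (λ h → v-odd (t , λ i → ∣-resp (e₂ (t i) (v i)) (∣m⇒∣-m (h i))))
          (λ i → divides 0ℤ (s₂ (t i) (v i))))
        (fu t x₃ (λ h → u-odd (t , λ i → ∣-resp (e₃ (t i) (u i)) (h i)))
          (λ i → divides 0ℤ (s₃ (t i) (u i)))))
      (fv x₃ x₄ (λ h → v-odd ((λ i → u i - t i) ,
          λ i → ∣-resp (e₄ (t i) (u i) (v i)) (h i)))
        (λ i → divides 0ℤ (s₄ (t i) (u i) (v i))))
      -- In the last step, equal endpoints would mean 2u = 2v.
      (fe x₄ x₀ (λ h → 2u≉2v (λ i → ∣-resp (e₅ (t i) (u i) (v i)) (∣m⇒∣-m (h i))))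
        (λ i → ∣-resp (s₅ (t i) (u i) (v i) (e i)) (t+t≋e i)))
      refl
    where
    x₀ x₁ x₃ x₄ : I → ℤ
    x₀ i = u i - v i + t i
    x₁ i = v i - t i
    x₃ i = u i - t i
    x₄ i = v i - u i + t i
    e₁ : ∀ t u v → - ((u - v + t) - (v - t)) ≡ (v - t) + (v - t) - u
    e₁ = solve-∀
    e₂ : ∀ t v → - ((v - t) - t) ≡ t + t - v
    e₂ = solve-∀
    e₃ : ∀ t u → t - (u - t) ≡ t + t - u
    e₃ = solve-∀
    e₄ : ∀ t u v → (u - t) - (v - u + t) ≡ (u - t) + (u - t) - v
    e₄ = solve-∀
    e₅ : ∀ t u v → - ((v - u + t) - (u - v + t)) ≡ (u + u) - (v + v)
    e₅ = solve-∀
    s₁ : ∀ t u v → (u - v + t) + (v - t) - u ≡ 0ℤ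
    s₁ = solve-∀
    s₂ : ∀ t v → (v - t) + t - v ≡ 0ℤ
    s₂ = solve-∀
    s₃ : ∀ t u → t + (u - t) - u ≡ 0ℤ
    s₃ = solve-∀
    s₄ : ∀ t u v → (u - t) + (v - u + t) - v ≡ 0ℤ
    s₄ = solve-∀
    s₅ : ∀ t u v e → t + t - e ≡ (v - u + t) + (u - v + t) - e
    s₅ = solve-∀

  -- The layered coloring and the sets that it avoids

  layers : List I → (I → ℤ) → Bool → Bool
  layers []       x b = b
  layers (i ∷ is) x b with + N i ∣? x i + x i
  ... | yes _ = layers is x b
  ... | no _  = half (N i) (x i)

  layers-cong : ∀ is {x y b b′} → x ≋ y → b ≡ b′ → layers is x b ≡ layers is y b′
  layers-cong [] x≋y b≡b′ = b≡b′
  layers-cong (i ∷ is) {x} {y} x≋y b≡b′ with + N i ∣? x i + x i | + N i ∣? y i + y i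
  ... | yes _ | yes _ = layers-cong is x≋y b≡b′
  ... | no _  | no _  = half-cong (N i) (x≋y i)
  ... | yes p | no ¬q = contradiction (∣-diff (double (x i) (y i)) p (∣m∣n⇒∣m+n (x≋y i) (x≋y i))) ¬q
    where
    double : ∀ a b → (a + a) - ((a - b) + (a - b)) ≡ b + b
    double = solve-∀
  ... | no ¬p | yes q = contradiction (∣-sum (double (x i) (y i)) (∣m∣n⇒∣m+n (x≋y i) (x≋y i)) q) ¬p
    where
    double : ∀ a b → ((a - b) + (a - b)) + (b + b) ≡ a + a
    double = solve-∀

  -- Opposite coordinates are either both self-inverse, hence equal, and the decision passes on, or
  -- neither is, and then they lie in different halves. The defaults are consulted only if all
  -- listed coordinates agree.
  layers-flip : ∀ is {x y b b′} → All (λ i → + N i ∣ x i + y i) is →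
    (All (λ i → + N i ∣ x i - y i) is → b ≢ b′) → layers is x b ≢ layers is y b′
  layers-flip [] _ tie = tie []
  layers-flip (i ∷ is) {x} {y} (p ∷ ps) tie with + N i ∣? x i + x i | + N i ∣? y i + y i
  ... | yes q | yes _ = layers-flip is ps (tie ∘ (∣-diff (subtract (x i) (y i)) q p ∷_))
    where
    subtract : ∀ a b → (a + a) - (a + b) ≡ a - b
    subtract = solve-∀
  ... | no ¬q | no _ = half-flip (N i) 0 z≤n (∣-resp (sym (ℤ.+-identityʳ _)) p)
    (λ d → ¬q (∣-sum (add (x i) (y i)) p d))
    where
    add : ∀ a b → (a + b) + (a - b) ≡ a + a
    add = solve-∀
  ... | yes q | no ¬r = contradiction (∣-diff (double (x i) (y i)) (∣m∣n⇒∣m+n p p) q) ¬r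
    where
    double : ∀ a b → ((a + b) + (a + b)) - (a + a) ≡ b + b
    double = solve-∀
  ... | no ¬q | yes r = contradiction (∣-diff (double (x i) (y i)) (∣m∣n⇒∣m+n p p) r) ¬q
    where
    double : ∀ a b → ((a + b) + (a + b)) - (b + b) ≡ a + a
    double = solve-∀

  zeros : I → ℤ
  zeros _ = 0ℤ

  -- Zero serves as the even element. The nonzero `u` ensures that both classes are nonempty, since
  -- 0 + u = u separates 0 from `u`.
  Realizes : ℕ → Set
  Realizes m = ∃ λ c → (∀ x y → x ≋ y → c x ≡ c y) × ∃ λ us → length us ≡ m
    × AllPairs (λ u v → ¬ u ≋ v) us × All (FlipsAt c) us × zeros ∈ us × ∃ λ u → u ∈ us × ¬ zeros ≋ u

  -- The layers compare x with its reflections coordinate by coordinate along the ordinary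
  -- indices; the linear form z decides whenever all of these coordinates are self-inverse.
  module Layered (indices : List I) (complete : ∀ i → i ∈ indices) (ordinary : I → Bool)
    (M : ℕ) (z : (I → ℤ) → ℤ) (z-⊞ : ∀ x y → z (x ⊞ y) ≡ z x + z y)
    (z-cong : ∀ x y → x ≋ y → + M ∣ z x - z y) where

    ordinaries : List I
    ordinaries = filter (T? ∘ ordinary) indices

    coloring : (I → ℤ) → Bool
    coloring x = layers ordinaries x (half M (z x))

    coloring-cong : ∀ x y → x ≋ y → coloring x ≡ coloring y
    coloring-cong x y x≋y = layers-cong ordinaries x≋y (half-cong M (z-cong x y x≋y))

    z-zeros : z zeros ≡ 0ℤ
    z-zeros = trans (regroup (z zeros)) (trans (cong (_- z zeros) (sym (z-⊞ zeros zeros))) (ℤ.+-inverseʳ (z zeros)))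
      where
      regroup : ∀ a → a ≡ a + a - a
      regroup = solve-∀

    -- Where `u` vanishes, x + y = u makes `x` and `y` opposite, so the layers settle every case but
    -- that of agreement, which is left to `z`.
    flipsAt : ∀ {u} → (∀ i → T (ordinary i) → u i ≡ 0ℤ) →
      (∀ x y → ¬ x ≋ y → x ⊞ y ≋ u → (∀ i → T (ordinary i) → + N i ∣ x i - y i) →
        + M ∣ z x + z y - z u → half M (z x) ≢ half M (z y)) → FlipsAt coloring u
    flipsAt {u} u≡0 tie x y x≉y x+y≋u = layers-flip ordinaries
      (All.tabulate λ {i} i∈ → ∣-resp (trans (cong (λ t → x i + y i - t) (u≡0 i (proj₂ (∈-filter⁻ (T? ∘ ordinary) {xs = indices} i∈))))
        (ℤ.+-identityʳ _)) (x+y≋u i))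
      (λ d → tie x y x≉y x+y≋u (λ i o → All.lookup d (∈-filter⁺ (T? ∘ ordinary) (complete i) o))
        (∣-resp (cong (_- z u) (z-⊞ x y)) (z-cong (x ⊞ y) u x+y≋u)))

    flipsAt-zeros : (∀ x y → x ⊞ y ≋ zeros → (∀ i → T (ordinary i) → + N i ∣ x i - y i) →
      + M ∣ z x - z y → x ≋ y) → FlipsAt coloring zeros
    flipsAt-zeros determined = flipsAt (λ _ _ → refl) λ x y x≉y s d zs →
      half-flip M 0 z≤n (∣-resp (cong (λ t → z x + z y - t) z-zeros) zs) (x≉y ∘ determined x y s d)

    -- Serves the groups of odd order: pairs on which the layers and `z` both agree are equal, so it
    -- suffices that `z` is reflected in 0 and in 1.
    realizes-pair : (∀ x y → (∀ i → T (ordinary i) → + N i ∣ x i - y i) → + M ∣ z x - z y → x ≋ y) →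
      ∀ o → (∀ i → T (ordinary i) → o i ≡ 0ℤ) → z o ≡ 1ℤ → ¬ (+ M ∣ 1ℤ) → Realizes 2
    realizes-pair determined o o≡0 z-o M∤1 = coloring , coloring-cong , zeros ∷ o ∷ [] , refl
      , (zeros≉o ∷ []) ∷ [] ∷ []
      , flipsAt-zeros (λ x y _ → determined x y)
        ∷ flipsAt o≡0 (λ x y x≉y _ d zs →
            half-flip M 1 (s≤s z≤n) (∣-resp (cong (λ t → z x + z y - t) z-o) zs) (x≉y ∘ determined x y d))
        ∷ []
      , here refl , o , there (here refl) , zeros≉o
      where
      zeros≉o : ¬ zeros ≋ o
      zeros≉o h = M∤1 (∣m⇒∣-m (∣-resp (cong₂ _-_ z-zeros z-o) (z-cong _ _ h)))

    -- Coordinates in which the family `odds` varies cannot be ordinary, because the layers flip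
    -- only where the target vanishes. Hence the ℤ/2 coordinates enter `determined` separately.
    module EvenModulus (2∣M : + 2 ∣ + M)
      (determined : ∀ x y → (∀ i → T (ordinary i) → + N i ∣ x i - y i) →
        (∀ i → N i ≡ 2 → + 2 ∣ x i - y i) → + M ∣ z x - z y → x ≋ y)
      {K : ℕ} (odds : (Fin K → Fin 2) → I → ℤ)
      (odds≡0 : ∀ e i → T (ordinary i) → odds e i ≡ 0ℤ)
      (z-odds : ∀ e → z (odds e) ≡ 1ℤ)
      (odds-injective : ∀ e e′ → odds e ≋ odds e′ → ∀ j → e j ≡ e′ j) where

      oddList : List (I → ℤ)
      oddList = tabulate (odds ∘ finToFun {2} {K})

      -- The sum 2h vanishes in each ℤ/2 coordinate, so `x` and `y` agree there automatically. This
      -- covers the targets 0 and 2o.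
      determined-double : ∀ h x y → x ⊞ y ≋ h ⊞ h → (∀ i → T (ordinary i) → + N i ∣ x i - y i) →
        + M ∣ z x - z y → x ≋ y
      determined-double h x y s d = determined x y d λ i N≡2 →
        ∣-diff (collect (x i) (y i) (h i)) (subst (λ k → + k ∣ x i + y i - (h i + h i)) N≡2 (s i)) (∣m⇒∣m*n (y i - h i) ∣-refl)
        where
        collect : ∀ x y h → x + y - (h + h) - + 2 * (y - h) ≡ x - y
        collect = solve-∀

      -- Values `z x` and `z y` with sum 1 modulo the even `M` always lie in different halves,
      -- whatever the ℤ/2 coordinates are.
      flipsAt-odds : ∀ e → FlipsAt coloring (odds e)
      flipsAt-odds e = flipsAt (odds≡0 e) λ x y _ _ _ zs →
        half-flip-odd-sum M 2∣M (∣-resp (cong (λ t → z x + z y - t) (z-odds e)) zs)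

      M∤1 : ¬ + M ∣ 1ℤ
      M∤1 = even∤1 ∘ ∣-trans 2∣M

      zeros≉odds : ∀ e → ¬ zeros ≋ odds e
      zeros≉odds e h = M∤1 (∣m⇒∣-m (∣-resp (cong₂ _-_ z-zeros (z-odds e)) (z-cong _ _ h)))

      oddList-distinct : AllPairs (λ u v → ¬ u ≋ v) oddList
      oddList-distinct = AllPairs.tabulate⁺ λ {k} {l} k≢l h → k≢l
        (trans (sym (funToFin-finToFin {K} k)) (trans (funToFin-cong (odds-injective _ _ h)) (funToFin-finToFin {K} l)))
        where
        funToFin-cong : ∀ {m n} {f g : Fin m → Fin n} → f ≗ g → funToFin f ≡ funToFin g
        funToFin-cong {zero}  _   = refl
        funToFin-cong {suc m} f≗g = cong₂ combine (f≗g Fin.zero) (funToFin-cong (f≗g ∘ Fin.suc))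

      someOdd : Fin (2 ^ K)
      someOdd = funToFin {K} (λ _ → Fin.zero)

      -- Serves the groups with ℤ/2 summands only, where 2o = 0.
      realizes-without-double : Realizes (1 ℕ.+ 2 ^ K)
      realizes-without-double = coloring , coloring-cong , zeros ∷ oddList
        , cong suc (length-tabulate _)
        , All.tabulate⁺ (zeros≉odds ∘ finToFun) ∷ oddList-distinct
        , flipsAt-zeros (determined-double zeros) ∷ All.tabulate⁺ (flipsAt-odds ∘ finToFun)
        , here refl , _ , there (∈-tabulate⁺ someOdd) , zeros≉odds _

      -- The values 0, 2 and 1 of `z` tell 0, 2o and the odd elements apart.
      realizes-with-double : ¬ (+ M ∣ + 2) → Realizes (2 ℕ.+ 2 ^ K)
      realizes-with-double M∤2 = coloring , coloring-cong , zeros ∷ double ∷ oddList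
        , cong (suc ∘ suc) (length-tabulate _)
        , ((λ h → M∤2 (∣m⇒∣-m (∣-resp (cong₂ _-_ z-zeros z-double) (z-cong _ _ h))))
            ∷ All.tabulate⁺ (zeros≉odds ∘ finToFun))
          ∷ All.tabulate⁺ (λ k h → M∤1 (∣-resp (cong₂ _-_ z-double (z-odds (finToFun k))) (z-cong _ _ h)))
          ∷ oddList-distinct
        , flipsAt-zeros (determined-double zeros) ∷ flipsAt-double ∷ All.tabulate⁺ (flipsAt-odds ∘ finToFun)
        , here refl , _ , there (there (∈-tabulate⁺ someOdd)) , zeros≉odds _
        where
        o double : I → ℤ
        o = odds (λ _ → Fin.zero)
        double = o ⊞ o
        z-double : z double ≡ + 2
        z-double = trans (z-⊞ o o) (cong₂ _+_ (z-odds _) (z-odds _))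
        flipsAt-double : FlipsAt coloring double
        flipsAt-double = flipsAt (λ i p → cong₂ _+_ (odds≡0 _ i p) (odds≡0 _ i p)) λ x y x≉y s d zs →
          half-flip-two-sum M 2∣M (∣-resp (cong (λ t → z x + z y - t) z-double) zs) (x≉y ∘ determined-double o x y s d)

  -- Upper bounds from parity

  even-sum : ∀ x y → x ≋ y → IsEven (x ⊞ y)
  even-sum x y x≋y = y , λ i → ∣-resp (rearrange (x i) (y i)) (∣m⇒∣-m (x≋y i))
    where
    rearrange : ∀ a b → - (a - b) ≡ b + b - (a + b)
    rearrange = solve-∀

  even-⊞-comm : ∀ {x y} → IsEven (x ⊞ y) → IsEven (y ⊞ x)
  even-⊞-comm {x} {y} (h , h+h≋) = h , λ i → ∣-resp (cong (λ t → h i + h i - t) (ℤ.+-comm (x i) (y i))) (h+h≋ i)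

  -- Parity of a coordinate is well defined for an even modulus, including 0.
  even-coordinate : ∀ {x i} → + 2 ∣ + N i → IsEven x → + 2 ∣ x i
  even-coordinate {x} {i} 2∣N (h , h+h≋x) =
    ∣-diff (rearrange (h i) (x i)) (∣m⇒∣m*n (h i) ∣-refl) (∣-trans 2∣N (h+h≋x i))
    where
    rearrange : ∀ h a → + 2 * h - (h + h - a) ≡ a
    rearrange = solve-∀

  Distinct≋ : List (I → ℤ) → Set
  Distinct≋ = AllPairs (λ u v → ¬ u ≋ v)

  evens≤2 : ∀ {c us} → All (FlipsAt c) us → All IsEven us → Distinct≋ us → length us ≤ 2
  evens≤2 {us = []} _ _ _ = z≤n
  evens≤2 {us = _ ∷ []} _ _ _ = s≤s z≤n
  evens≤2 {us = _ ∷ _ ∷ []} _ _ _ = ℕ.≤-refl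
  evens≤2 (fu ∷ fv ∷ fw ∷ _) (eu ∷ ev ∷ ew ∷ _) ((u≉v ∷ u≉w ∷ _) ∷ (v≉w ∷ _) ∷ _) =
    contradiction (even-⊞ (even-⊞ eu ev) ew) (no-even-triple fu fv fw u≉v v≉w u≉w)

  module OddElements {c e} (fe : FlipsAt c e) (e-even : IsEven e) where

    -- Otherwise `u`, `v` and `e`, which differs from both in parity, would be three distinct
    -- elements with even sum.
    odd-sum : ∀ {u v} → FlipsAt c u → FlipsAt c v → ¬ IsEven u → ¬ IsEven v → ¬ u ≋ v → ¬ IsEven (u ⊞ v)
    odd-sum {u} {v} fu fv u-odd v-odd u≉v u+v-even = no-even-triple fu fv fe u≉v
      (λ v≋e → v-odd (even-resp (≋-sym v e v≋e) e-even)) (λ u≋e → u-odd (even-resp (≋-sym u e u≋e) e-even))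
      (even-⊞ u+v-even e-even)

    -- Distinct elements fall under `no-even-triple`. If two coincide, their sum is even, so an even
    -- total would make the third one even.
    odd-sum₃ : ∀ {u v w} → FlipsAt c u → FlipsAt c v → FlipsAt c w →
      ¬ IsEven u → ¬ IsEven v → ¬ IsEven w → ¬ IsEven (u ⊞ v ⊞ w)
    odd-sum₃ {u} {v} {w} fu fv fw u-odd v-odd w-odd sum-even = no-even-triple fu fv fw
      (λ u≋v → w-odd (even-⊞-cancelʳ (even-⊞-comm {u ⊞ v} {w} sum-even) (even-sum u v u≋v)))
      (λ v≋w → u-odd (even-⊞-cancelʳ (even-shift zeros (λ i → divides 0ℤ (e₁ (u i) (v i) (w i))) sum-even) (even-sum v w v≋w)))
      (λ u≋w → v-odd (even-⊞-cancelʳ (even-shift zeros (λ i → divides 0ℤ (e₂ (u i) (v i) (w i))) sum-even) (even-sum u w u≋w)))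
      sum-even
      where
      e₁ : ∀ u v w → (u + v + w) + (0ℤ + 0ℤ) - (u + (v + w)) ≡ 0ℤ
      e₁ = solve-∀
      e₂ : ∀ u v w → (u + v + w) + (0ℤ + 0ℤ) - (v + (u + w)) ≡ 0ℤ
      e₂ = solve-∀

    -- No translate by an odd element meets the list again, as three odd elements have an odd sum.
    odd-and-translate : ∀ {us u₀} → All (FlipsAt c) us → All (¬_ ∘ IsEven) us → Distinct≋ us → u₀ ∈ us →
      AllPairs (λ x y → ¬ IsEven (x ⊞ y)) (us ++ map (u₀ ⊞_) us)
    odd-and-translate {us} {u₀} fs odds distinct u₀∈ = AllPairs.++⁺ sums
      -- Within the translate, sums change only by 2u₀.
      (AllPairs.map⁺ (AllPairs.map (λ {x} {y} → translate x y) sums))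
      -- Across the two lists, x + (u₀ + y) is a sum of three odd elements, possibly with
      -- repetitions.
      (All.tabulate λ {x} x∈ → All.map⁺ (All.tabulate λ {y} y∈ s →
        odd-sum₃ (All.lookup fs x∈) (All.lookup fs u₀∈) (All.lookup fs y∈)
          (All.lookup odds x∈) (All.lookup odds u₀∈) (All.lookup odds y∈)
          (even-shift zeros (λ i → divides 0ℤ (e₁ (x i) (u₀ i) (y i))) s)))
      where
      e₁ : ∀ x u y → (x + (u + y)) + (0ℤ + 0ℤ) - (x + u + y) ≡ 0ℤ
      e₁ = solve-∀
      e₂ : ∀ x u y → (u + x + (u + y)) + (- u + - u) - (x + y) ≡ 0ℤ
      e₂ = solve-∀
      translate : ∀ x y → ¬ IsEven (x ⊞ y) → ¬ IsEven ((u₀ ⊞ x) ⊞ (u₀ ⊞ y))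
      translate x y ne s = ne (even-shift (λ i → - u₀ i) (λ i → divides 0ℤ (e₂ (x i) (u₀ i) (y i))) s)
      pairs : ∀ {us} → All (FlipsAt c) us → All (¬_ ∘ IsEven) us → Distinct≋ us → AllPairs (λ x y → ¬ IsEven (x ⊞ y)) us
      pairs [] [] [] = []
      pairs (fu ∷ fs) (u-odd ∷ odds) (u≉ ∷ distinct) =
        All.tabulate (λ v∈ → odd-sum fu (All.lookup fs v∈) u-odd (All.lookup odds v∈) (All.lookup u≉ v∈))
        ∷ pairs fs odds distinct
      sums : AllPairs (λ x y → ¬ IsEven (x ⊞ y)) us
      sums = pairs fs odds distinct

  -- The even element is kept apart from the list, which may be any selection from the avoidable
  -- set.
  Bound : ℕ → Set
  Bound m = ∀ c e → FlipsAt c e → IsEven e → ∀ us → Distinct≋ us → All (FlipsAt c) us → length us ≤ m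

  bound-by-parity : (∀ x → Dec (IsEven x)) → ∀ {a b} →
    (∀ {c e us} → FlipsAt c e → IsEven e → All (FlipsAt c) us → All IsEven us → Distinct≋ us → length us ≤ a) →
    (∀ {c e us} → FlipsAt c e → IsEven e → All (FlipsAt c) us → All (¬_ ∘ IsEven) us → Distinct≋ us → length us ≤ b) →
    Bound (a ℕ.+ b)
  bound-by-parity even? bound-evens bound-odds c e fe e-even us distinct fs =
    subst (_≤ _) (length-split us) (ℕ.+-mono-≤
      (bound-evens fe e-even (All.filter⁺ even? fs) (All.all-filter even? us) (AllPairs.filter⁺ even? distinct))
      (bound-odds fe e-even (All.filter⁺ odd? fs) (All.all-filter odd? us) (AllPairs.filter⁺ odd? distinct)))
    where
    odd? : ∀ x → Dec (¬ IsEven x)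
    odd? x = ¬? (even? x)
    length-split : ∀ us → length (filter even? us) ℕ.+ length (filter odd? us) ≡ length us
    length-split [] = refl
    length-split (u ∷ us) with even? u
    ... | yes _ = cong suc (length-split us)
    ... | no _  = trans (ℕ.+-suc _ _) (cong suc (length-split us))

-- Turns distinct entries into an injection for the pigeonhole argument in `distinct-twos`.
lookup-injective : ∀ {A : Set} {xs : List A} → AllPairs _≢_ xs → ∀ i j → lookup xs i ≡ lookup xs j → i ≡ j
lookup-injective (x≢ ∷ ps) Fin.zero    Fin.zero    _  = refl
lookup-injective (x≢ ∷ ps) Fin.zero    (Fin.suc j) eq = contradiction eq (All.lookup x≢ (∈-lookup j))
lookup-injective (x≢ ∷ ps) (Fin.suc i) Fin.zero    eq = contradiction (sym eq) (All.lookup x≢ (∈-lookup i))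
lookup-injective (x≢ ∷ ps) (Fin.suc i) (Fin.suc j) eq = cong Fin.suc (lookup-injective ps i j eq)

-- The group of the theorem as a product of cyclic groups

module Coordinates (m1 m2 m3 r : ℕ) (n : Fin m1 → ℕ) (q : Fin m3 → ℕ) where

  open Group m1 m2 m3 r n q

  data Index : Set where
    odd  : Fin m1 → Index
    two  : Fin m2 → Index
    four : Fin m3 → Index
    free : Fin r  → Index

  modulus : Index → ℕ
  modulus (odd i)  = 2 ℕ.* n i ℕ.+ 1
  modulus (two _)  = 2
  modulus (four i) = 4 ℕ.* q i
  modulus (free _) = 0

  open Congruences modulus public

  indices : List Index
  indices = map odd (allFin m1) ++ map two (allFin m2) ++ map four (allFin m3) ++ map free (allFin r)

  complete : ∀ ι → ι ∈ indices
  complete (odd i)  = ∈-++⁺ˡ (∈-map⁺ odd (∈-allFin i))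
  complete (two i)  = ∈-++⁺ʳ (map odd (allFin m1)) (∈-++⁺ˡ (∈-map⁺ two (∈-allFin i)))
  complete (four i) = ∈-++⁺ʳ (map odd (allFin m1)) (∈-++⁺ʳ (map two (allFin m2)) (∈-++⁺ˡ (∈-map⁺ four (∈-allFin i))))
  complete (free i) = ∈-++⁺ʳ (map odd (allFin m1)) (∈-++⁺ʳ (map two (allFin m2))
    (∈-++⁺ʳ (map four (allFin m3)) (∈-map⁺ free (∈-allFin i))))

  coords : G → Index → ℤ
  coords x (odd i)  = odd-part x i
  coords x (two i)  = two-part x i
  coords x (four i) = four-part x i
  coords x (free i) = free-part x i

  element : (Index → ℤ) → G
  element h = ⟨ h ∘ odd , h ∘ two , h ∘ four , h ∘ free ⟩

  ≈⇒≋ : ∀ x y → element x ≈ element y → x ≋ y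
  ≈⇒≋ x y (o , _ , _ , _) (odd i)  = ∣ᵤ⇒∣ (o i)
  ≈⇒≋ x y (_ , t , _ , _) (two i)  = ∣ᵤ⇒∣ (t i)
  ≈⇒≋ x y (_ , _ , f , _) (four i) = ∣ᵤ⇒∣ (f i)
  ≈⇒≋ x y (_ , _ , _ , z) (free i) = divides 0ℤ (ℤ.i≡j⇒i-j≡0 (z i))

  ≋⇒≈ : ∀ x y → x ≋ y → element x ≈ element y
  ≋⇒≈ x y h = ∣⇒∣ᵤ ∘ h ∘ odd , ∣⇒∣ᵤ ∘ h ∘ two , ∣⇒∣ᵤ ∘ h ∘ four
    , λ i → ℤ.i-j≡0⇒i≡j (x (free i)) (y (free i)) (0∣⇒≡0 (h (free i)))

  element-refl : ∀ x → element x ≈ element x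
  element-refl x = ≋⇒≈ x x (∣-refl⁰ ∘ x)

  isMax : ∀ {m} → Realizes m → Bound m → IsMaxAvoidableEvenSize m
  isMax (c , c-cong , us , us-length , us-distinct , flips , zeros∈ , u , u∈ , 0≉u) bound =
      ( map element us , trans (length-map element us) us-length
      , AllPairs.map⁺ (AllPairs.map (λ {u} {v} u≉v → u≉v ∘ ≈⇒≋ u v) us-distinct)
      , (c ∘ coords
        , (λ x y x≈y → c-cong (coords x) (coords y) (≈⇒≋ (coords x) (coords y) x≈y))
        , colored true , colored false
        , λ v x y v∈ x≉y same x+y≈v → let w , w∈ , v≈w = find (Any.map⁻ v∈) in
            All.lookup flips w∈ (coords x) (coords y) (x≉y ∘ ≋⇒≈ (coords x) (coords y))
              (λ ι → ∣-sum (telescope (coords x ι) (coords y ι) (coords v ι) (w ι))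
                (≈⇒≋ (coords x ⊞ coords y) (coords v) x+y≈v ι) (≈⇒≋ (coords v) w v≈w ι))
              same)
      , element zeros , Any.map⁺ (Any.map (λ { refl → element-refl zeros }) zeros∈)
      , element zeros , element-refl zeros )
    , λ U (col , _ , _ , _ , avoids) (e , e∈U , h , h+h≈e) xs xs⊆U xs-distinct →
        let flipsAt : ∀ {v} → U v → FlipsAt (col ∘ element) (coords v)
            flipsAt {v} v∈U = λ x y x≉y x+y≋v same →
              avoids v (element x) (element y) v∈U (x≉y ∘ ≈⇒≋ x y) same (≋⇒≈ (x ⊞ y) (coords v) x+y≋v)
        in subst (_≤ _) (length-map coords xs)
          (bound (col ∘ element) (coords e) (flipsAt e∈U) (coords h , ≈⇒≋ (coords h ⊞ coords h) (coords e) h+h≈e)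
            (map coords xs)
            (AllPairs.map⁺ (AllPairs.map (λ {x} {y} x≉y → x≉y ∘ ≋⇒≈ (coords x) (coords y)) xs-distinct))
            (All.map⁺ (All.map flipsAt xs⊆U)))
    where
    telescope : ∀ x y v w → (x + y - v) + (v - w) ≡ x + y - w
    telescope = solve-∀
    -- The round trip returns `h` only pointwise, so the color is carried over by `c-cong`.
    c-element : ∀ h → c (coords (element h)) ≡ c h
    c-element h = c-cong (coords (element h)) h (≈⇒≋ (coords (element h)) h (element-refl h))
    0≢u : c zeros ≢ c u
    0≢u = All.lookup flips u∈ zeros u 0≉u (λ ι → divides 0ℤ (cancel (u ι)))
      where
      cancel : ∀ a → 0ℤ + a - a ≡ 0ℤ
      cancel = solve-∀
    colored : ∀ b → ∃ λ x → c (coords x) ≡ b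
    colored b with c zeros Bool.≟ b
    ... | yes eq = element zeros , trans (c-element zeros) eq
    ... | no ne  = element u , trans (c-element u) (trans (¬-not (0≢u ∘ sym)) (trans (cong not (¬-not ne)) (not-involutive b)))

  -- Evenness in coordinates

  even-from-halves : ∀ {x} → (∀ ι → ∃ λ h → + modulus ι ∣ h + h - x ι) → IsEven x
  even-from-halves halves = (λ ι → proj₁ (halves ι)) , λ ι → proj₂ (halves ι)

  -- The inverse of 2 modulo 2k + 1 is k + 1.
  half-odd : ∀ k a → ∃ λ h → + (2 ℕ.* k ℕ.+ 1) ∣ h + h - a
  half-odd k a = a * (+ k + 1ℤ) , divides a (trans (expand a (+ k))
    (cong (a *_) (trans (cong (_+ 1ℤ) (sym (ℤ.pos-* 2 k))) (sym (ℤ.pos-+ (2 ℕ.* k) 1)))))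
    where
    expand : ∀ a k → a * (k + 1ℤ) + a * (k + 1ℤ) - a ≡ a * (+ 2 * k + 1ℤ)
    expand = solve-∀

  half-even : ∀ {m a} → + 2 ∣ a → ∃ λ h → m ∣ h + h - a
  half-even (divides h refl) = h , divides 0ℤ (cancel h)
    where
    cancel : ∀ h → h + h - h * + 2 ≡ 0ℤ
    cancel = solve-∀

  -- Odd moduli allow every halving; in the other summands only the parity of the representative
  -- counts.
  even? : ∀ x → Dec (IsEven x)
  even? x = map′
    (λ (t , f , z) → even-from-halves {x} λ where
      (odd i)  → half-odd (n i) (x (odd i))
      (two i)  → half-even (t i)
      (four i) → half-even (f i)
      (free i) → half-even (z i))
    (λ e → (λ i → even-coordinate {x} {two i} ∣-refl e)
         , (λ i → even-coordinate {x} {four i} (2∣4q i) e)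
         , (λ i → even-coordinate {x} {free i} (divides 0ℤ refl) e))
    (all? (λ i → + 2 ∣? x (two i)) ×-dec all? (λ i → + 2 ∣? x (four i)) ×-dec all? (λ i → + 2 ∣? x (free i)))
    where
    2∣4q : ∀ i → + 2 ∣ + (4 ℕ.* q i)
    2∣4q i = ∣ᵤ⇒∣ (ℕ.∣m⇒∣m*n (q i) (ℕ.divides 2 refl))

  -- Counting odd elements through their ℤ/2 coordinates

  same-parity : ∀ a b → + 2 ∣ a - b → + 2 ∣ a + b
  same-parity a b d = ∣-sum (shift a b) d (∣m⇒∣m*n b ∣-refl)
    where
    shift : ∀ a b → (a - b) + + 2 * b ≡ a + b
    shift = solve-∀

  TwosAgree : (Index → ℤ) → (Index → ℤ) → Set
  TwosAgree x y = ∀ j → + 2 ∣ x (two j) - y (two j)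

  -- Pigeonhole: the parities of the ℤ/2 coordinates form a code with 2^m₂ values.
  distinct-twos : ∀ {us} → AllPairs (λ x y → ¬ TwosAgree x y) us → length us ≤ 2 ^ m2
  distinct-twos {us} ps = subst (_≤ 2 ^ m2) (length-map code us)
    (injective⇒≤ (lookup-injective (AllPairs.map⁺ (AllPairs.map (λ {x} {y} ne → ne ∘ code-agree x y) ps)) _ _))
    where
    bit : ℤ → Fin 2
    bit a = fromℕ< (n%ℕd<d a 2)
    code : (Index → ℤ) → Fin (2 ^ m2)
    code x = funToFin (bit ∘ x ∘ two)
    bits-agree : ∀ a b → bit a ≡ bit b → + 2 ∣ a - b
    bits-agree a b eq = ∣-diff (rearrange a b (+ (a %ℕ 2)) (+ (b %ℕ 2))) (∣-residue a 2)
      (subst (λ t → + 2 ∣ b - + t) (sym (fromℕ<-injective (a %ℕ 2) (b %ℕ 2) (n%ℕd<d a 2) (n%ℕd<d b 2) eq)) (∣-residue b 2))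
      where
      rearrange : ∀ a b s t → (a - s) - (b - s) ≡ a - b
      rearrange = solve-∀
    code-agree : ∀ x y → code x ≡ code y → TwosAgree x y
    code-agree x y eq j = bits-agree (x (two j)) (y (two j))
      (trans (sym (finToFun-funToFin (bit ∘ x ∘ two) j))
        (trans (cong (λ k → finToFun k j) eq) (finToFun-funToFin (bit ∘ y ∘ two) j)))

  -- Equal doubles give equality in ℤ, and equal parity in ℤ/4q because 4 divides 2(x - y). In ℤ/2
  -- doubles carry no information, hence the hypothesis of agreement.
  even-sum-of-equal-doubles : ∀ {x y} → TwosAgree x y → x ⊞ x ≋ y ⊞ y → IsEven (x ⊞ y)
  even-sum-of-equal-doubles {x} {y} agree doubles = even-from-halves λ where
      (odd i)  → half-odd (n i) _
      (two i)  → half-even (same-parity (x (two i)) (y (two i)) (agree i))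
      (four i) → half-even (same-parity (x (four i)) (y (four i))
        (*-cancelˡ-∣ (+ 2) {+ 2} (∣-resp (double (x (four i)) (y (four i)))
          (∣-trans (∣ᵤ⇒∣ {+ 4} (ℕ.m∣m*n (q i))) (doubles (four i))))))
      (free i) → half-even (same-parity (x (free i)) (y (free i))
        (∣-resp (sym (ℤ.*-cancelˡ-≡ (+ 2) (x (free i) - y (free i)) 0ℤ (trans (sym (double (x (free i)) (y (free i)))) (0∣⇒≡0 (doubles (free i))))))
          (divides 0ℤ refl)))
    where
    double : ∀ a b → (a + a) - (b + b) ≡ + 2 * (a - b)
    double = solve-∀

  bound-odds : ∀ {c e us} → FlipsAt c e → IsEven e → All (FlipsAt c) us → All (¬_ ∘ IsEven) us → Distinct≋ us →
    length us ≤ 2 ^ m2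
  bound-odds {c} {us = us} fe e-even fs odds distinct = distinct-twos (pairs fs odds distinct)
    where
    open OddElements fe e-even
    pairs : ∀ {us} → All (FlipsAt c) us → All (¬_ ∘ IsEven) us → Distinct≋ us → AllPairs (λ x y → ¬ TwosAgree x y) us
    pairs [] [] [] = []
    pairs {u ∷ _} (fu ∷ fs) (u-odd ∷ odds) (u≉ ∷ distinct) = All.tabulate (λ {v} v∈ agree →
        -- Equality of the doubles is known only up to double negation, which suffices for a
        -- contradiction.
        odd-doubles-agree fu (All.lookup fs v∈) fe e-even u-odd (All.lookup odds v∈) λ doubles →
          odd-sum fu (All.lookup fs v∈) u-odd (All.lookup odds v∈) (All.lookup u≉ v∈) (even-sum-of-equal-doubles {u} {v} agree doubles))
      ∷ pairs fs odds distinct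

  bound-general : Bound (2 ℕ.+ 2 ^ m2)
  bound-general = bound-by-parity even? (λ _ _ → evens≤2) bound-odds

-- The maximal sizes, by the shape of the group

toℕ-injective-mod-2 : ∀ (a b : Fin 2) → + 2 ∣ + toℕ a - + toℕ b → a ≡ b
toℕ-injective-mod-2 a b = toℕ-injective ∘ residues-unique (toℕ<n a) (toℕ<n b)

2k+1≢1 : ∀ {k} → 1 ≤ k → 2 ℕ.* k ℕ.+ 1 ≢ 1
2k+1≢1 1≤k eq = ℕ.<⇒≢ (ℕ.+-monoˡ-≤ 1 (ℕ.≤-trans 1≤k (ℕ.m≤m+n _ _))) (sym eq)

module WithFour (m1 m2 m3 r : ℕ) (n : Fin m1 → ℕ) (q : Fin (suc m3) → ℕ) where

  open Coordinates m1 m2 (suc m3) r n q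

  -- The first ℤ/4q coordinate is reserved for `z`, and the ℤ/2 coordinates for the variation of the
  -- odd elements.
  ordinary : Index → Bool
  ordinary (two _)         = false
  ordinary (four Fin.zero) = false
  ordinary _               = true

  odds : (Fin m2 → Fin 2) → Index → ℤ
  odds e (two j)         = + toℕ (e j)
  odds e (four Fin.zero) = 1ℤ
  odds e _               = 0ℤ

  realizes : 1 ≤ q Fin.zero → Realizes (2 ℕ.+ 2 ^ m2)
  -- The modulus is a multiple of 4, so it cannot divide 2.
  realizes 1≤q = realizes-with-double λ M∣2 → ℕ.<⇒≱ (s≤s (s≤s (s≤s z≤n)))
      (ℕ.∣⇒≤ (ℕ.∣-trans (ℕ.m∣m*n {4} (q Fin.zero)) (∣⇒∣ᵤ M∣2)))
    where
    odds≡0 : ∀ e ι → T (ordinary ι) → odds e ι ≡ 0ℤ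
    odds≡0 e (odd _)            _ = refl
    odds≡0 e (four (Fin.suc _)) _ = refl
    odds≡0 e (free _)           _ = refl
    determined : ∀ x y → (∀ ι → T (ordinary ι) → + modulus ι ∣ x ι - y ι) →
      (∀ ι → modulus ι ≡ 2 → + 2 ∣ x ι - y ι) → + modulus (four Fin.zero) ∣ x (four Fin.zero) - y (four Fin.zero) → x ≋ y
    determined x y d t z (odd i)            = d (odd i) _
    determined x y d t z (two j)            = t (two j) refl
    determined x y d t z (four Fin.zero)    = z
    determined x y d t z (four (Fin.suc i)) = d (four (Fin.suc i)) _
    determined x y d t z (free i)           = d (free i) _
    open Layered indices complete ordinary (modulus (four Fin.zero)) (λ x → x (four Fin.zero)) (λ _ _ → refl)
      (λ _ _ x≋y → x≋y (four Fin.zero))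
    open EvenModulus (∣ᵤ⇒∣ (ℕ.∣m⇒∣m*n (q Fin.zero) (ℕ.divides 2 refl))) determined odds odds≡0 (λ _ → refl)
      (λ e e′ h j → toℕ-injective-mod-2 (e j) (e′ j) (h (two j)))

module WithFree (m1 m2 m3 r : ℕ) (n : Fin m1 → ℕ) (q : Fin m3 → ℕ) where

  open Coordinates m1 m2 m3 (suc r) n q

  ordinary : Index → Bool
  ordinary (two _)         = false
  ordinary (free Fin.zero) = false
  ordinary _               = true

  odds : (Fin m2 → Fin 2) → Index → ℤ
  odds e (two j)         = + toℕ (e j)
  odds e (free Fin.zero) = 1ℤ
  odds e _               = 0ℤ

  realizes : Realizes (2 ℕ.+ 2 ^ m2)
  realizes = realizes-with-double λ 0∣2 → contradiction (0∣⇒≡0 0∣2) λ ()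
    where
    odds≡0 : ∀ e ι → T (ordinary ι) → odds e ι ≡ 0ℤ
    odds≡0 e (odd _)            _ = refl
    odds≡0 e (four _)           _ = refl
    odds≡0 e (free (Fin.suc _)) _ = refl
    determined : ∀ x y → (∀ ι → T (ordinary ι) → + modulus ι ∣ x ι - y ι) →
      (∀ ι → modulus ι ≡ 2 → + 2 ∣ x ι - y ι) → 0ℤ ∣ x (free Fin.zero) - y (free Fin.zero) → x ≋ y
    determined x y d t z (odd i)            = d (odd i) _
    determined x y d t z (two j)            = t (two j) refl
    determined x y d t z (four i)           = d (four i) _
    determined x y d t z (free Fin.zero)    = z
    determined x y d t z (free (Fin.suc i)) = d (free (Fin.suc i)) _
    open Layered indices complete ordinary 0 (λ x → x (free Fin.zero)) (λ _ _ → refl)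
      (λ _ _ x≋y → x≋y (free Fin.zero))
    open EvenModulus (divides 0ℤ refl) determined odds odds≡0 (λ _ → refl)
      (λ e e′ h j → toℕ-injective-mod-2 (e j) (e′ j) (h (two j)))

module OddAndTwos (m1 k : ℕ) (n : Fin m1 → ℕ) (q : Fin 0 → ℕ) where

  open Coordinates m1 (suc k) 0 0 n q

  -- Here the ℤ/2 coordinates determine the class modulo 2G. The list and its translate by `u₀` are
  -- pairwise incongruent modulo 2G, so together they have at most 2^(k + 1) entries.
  bound-odds-by-half : ∀ {c e us} → FlipsAt c e → IsEven e → All (FlipsAt c) us → All (¬_ ∘ IsEven) us → Distinct≋ us →
    length us ≤ 2 ^ k
  bound-odds-by-half {us = []} _ _ _ _ _ = z≤n
  bound-odds-by-half {us = us@(u₀ ∷ _)} fe e-even fs odds distinct = ℕ.*-cancelˡ-≤ 2 (begin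
      2 ℕ.* length us                      ≡⟨ cong (length us ℕ.+_) (ℕ.+-identityʳ (length us)) ⟩
      length us ℕ.+ length us              ≡⟨ cong (length us ℕ.+_) (length-map (u₀ ⊞_) us) ⟨
      length us ℕ.+ length (map (u₀ ⊞_) us) ≡⟨ length-++ us ⟨
      length (us ++ map (u₀ ⊞_) us)        ≤⟨ distinct-twos (AllPairs.map (λ {x} {y} ne → ne ∘ even-sum-of-agreeing x y)
                                                (odd-and-translate fs odds distinct (here refl))) ⟩
      2 ^ suc k ∎)
    where
    open ℕ.≤-Reasoning
    open OddElements fe e-even
    even-sum-of-agreeing : ∀ x y → TwosAgree x y → IsEven (x ⊞ y)
    even-sum-of-agreeing x y agree = even-from-halves λ where
      (odd i) → half-odd (n i) _
      (two j) → half-even (same-parity (x (two j)) (y (two j)) (agree j))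

module OddTimesTwos (m1 k : ℕ) (n : Fin (suc m1) → ℕ) (q : Fin 0 → ℕ) where

  open Coordinates (suc m1) (suc k) 0 0 n q
  open OddAndTwos (suc m1) k n q

  bound : Bound (2 ℕ.+ 2 ^ k)
  bound = bound-by-parity even? (λ _ _ → evens≤2) bound-odds-by-half

  ordinary : Index → Bool
  ordinary (odd (Fin.suc _)) = true
  ordinary _                 = false

  -- The two entries 1 form a generator of the cyclic group ℤ/(2n + 1) × ℤ/2; the other `k`
  -- coordinates of order 2 vary.
  odds : (Fin k → Fin 2) → Index → ℤ
  odds e (odd Fin.zero)    = 1ℤ
  odds e (two Fin.zero)    = 1ℤ
  odds e (two (Fin.suc j)) = + toℕ (e j)
  odds e _                 = 0ℤ

  realizes : 1 ≤ n Fin.zero → Realizes (2 ℕ.+ 2 ^ k)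
  realizes 1≤n = realizes-with-double λ M∣2 → 2k+1≢1 1≤n (ℕ.∣1⇒≡1 (ℕ.*-cancelˡ-∣ 2 (∣⇒∣ᵤ M∣2)))
    where
    ν : ℤ
    ν = + n Fin.zero
    -- The isomorphism ℤ/(2ν + 1) × ℤ/2 ≅ ℤ/(2 (2ν + 1)) of the Chinese remainder theorem.
    z : (Index → ℤ) → ℤ
    z x = (+ 2 * ν + + 2) * x (odd Fin.zero) - (+ 2 * ν + 1ℤ) * x (two Fin.zero)
    M : ℕ
    M = 2 ℕ.* (2 ℕ.* n Fin.zero ℕ.+ 1)
    modulus≡ : + (2 ℕ.* n Fin.zero ℕ.+ 1) ≡ + 2 * ν + 1ℤ
    modulus≡ = cong (_+ 1ℤ) (ℤ.pos-* 2 (n Fin.zero))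
    M≡ : + M ≡ + 2 * (+ 2 * ν + 1ℤ)
    M≡ = trans (ℤ.pos-* 2 (2 ℕ.* n Fin.zero ℕ.+ 1)) (cong (+ 2 *_) modulus≡)
    z-⊞ : ∀ x y → z (x ⊞ y) ≡ z x + z y
    z-⊞ x y = additive ν (x (odd Fin.zero)) (x (two Fin.zero)) (y (odd Fin.zero)) (y (two Fin.zero))
      where
      additive : ∀ ν a b c d → (+ 2 * ν + + 2) * (a + c) - (+ 2 * ν + 1ℤ) * (b + d) ≡
        ((+ 2 * ν + + 2) * a - (+ 2 * ν + 1ℤ) * b) + ((+ 2 * ν + + 2) * c - (+ 2 * ν + 1ℤ) * d)
      additive = solve-∀
    z-diff : ∀ ν a b c d → ((+ 2 * ν + + 2) * a - (+ 2 * ν + 1ℤ) * b) - ((+ 2 * ν + + 2) * c - (+ 2 * ν + 1ℤ) * d) ≡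
      (+ 2 * ν + + 2) * (a - c) - (+ 2 * ν + 1ℤ) * (b - d)
    z-diff = solve-∀
    -- The even coefficient 2ν + 2 meets a multiple of 2ν + 1, and the coefficient 2ν + 1 meets a
    -- multiple of 2.
    z-cong : ∀ x y → x ≋ y → + M ∣ z x - z y
    z-cong x y x≋y with x≋y (odd Fin.zero) | x≋y (two Fin.zero)
    ... | divides s eq | divides t eq′ = divides (s * (ν + 1ℤ) - t) (trans (z-diff ν (x (odd Fin.zero)) _ _ _)
      (trans (cong₂ (λ a b → (+ 2 * ν + + 2) * a - (+ 2 * ν + 1ℤ) * b) (trans eq (cong (s *_) modulus≡)) eq′)
        (trans (factor ν s t) (cong ((s * (ν + 1ℤ) - t) *_) (sym M≡)))))
      where
      factor : ∀ ν s t → (+ 2 * ν + + 2) * (s * (+ 2 * ν + 1ℤ)) - (+ 2 * ν + 1ℤ) * (t * + 2) ≡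
        (s * (ν + 1ℤ) - t) * (+ 2 * (+ 2 * ν + 1ℤ))
      factor = solve-∀
    -- Modulo 2ν + 1 the coefficients of `z` are 1 and 0.
    z-odd : ∀ x y → + M ∣ z x - z y → + modulus (odd Fin.zero) ∣ x (odd Fin.zero) - y (odd Fin.zero)
    z-odd x y M∣ = ∣-diff
        (recover ν (x (odd Fin.zero)) (x (two Fin.zero)) (y (odd Fin.zero)) (y (two Fin.zero)))
        (∣-trans (∣ᵤ⇒∣ (ℕ.n∣m*n 2)) M∣)
        (∣m⇒∣m*n (x (odd Fin.zero) - y (odd Fin.zero) - (x (two Fin.zero) - y (two Fin.zero))) (∣-reflexive modulus≡))
      where
      recover : ∀ ν a b c d →
        (((+ 2 * ν + + 2) * a - (+ 2 * ν + 1ℤ) * b) - ((+ 2 * ν + + 2) * c - (+ 2 * ν + 1ℤ) * d))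
          - (+ 2 * ν + 1ℤ) * (a - c - (b - d)) ≡ a - c
      recover = solve-∀
    z-odds : ∀ e → z (odds e) ≡ 1ℤ
    z-odds e = unit ν
      where
      unit : ∀ ν → (+ 2 * ν + + 2) * 1ℤ - (+ 2 * ν + 1ℤ) * 1ℤ ≡ 1ℤ
      unit = solve-∀
    odds≡0 : ∀ e ι → T (ordinary ι) → odds e ι ≡ 0ℤ
    odds≡0 e (odd (Fin.suc _)) _ = refl
    determined : ∀ x y → (∀ ι → T (ordinary ι) → + modulus ι ∣ x ι - y ι) →
      (∀ ι → modulus ι ≡ 2 → + 2 ∣ x ι - y ι) → + M ∣ z x - z y → x ≋ y
    determined x y d t M∣ (odd Fin.zero)    = z-odd x y M∣
    determined x y d t M∣ (odd (Fin.suc i)) = d (odd (Fin.suc i)) _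
    determined x y d t M∣ (two j)           = t (two j) refl
    open Layered indices complete ordinary M z z-⊞ z-cong
    open EvenModulus (∣ᵤ⇒∣ (ℕ.m∣m*n (2 ℕ.* n Fin.zero ℕ.+ 1))) determined odds odds≡0 z-odds
      (λ e e′ h j → toℕ-injective-mod-2 (e j) (e′ j) (h (two (Fin.suc j))))

module OnlyTwos (k : ℕ) (n : Fin 0 → ℕ) (q : Fin 0 → ℕ) where

  open Coordinates 0 (suc k) 0 0 n q
  open OddAndTwos 0 k n q

  bound : Bound (1 ℕ.+ 2 ^ k)
  bound = bound-by-parity even? (λ _ _ _ → evens≤1) bound-odds-by-half
    where
    -- Here 2G = 0, so all even elements coincide.
    evens≤1 : ∀ {us} → All IsEven us → Distinct≋ us → length us ≤ 1
    evens≤1 {[]} _ _ = z≤n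
    evens≤1 {_ ∷ []} _ _ = ℕ.≤-refl
    evens≤1 {u ∷ v ∷ _} (eu ∷ ev ∷ _) ((u≉v ∷ _) ∷ _) = contradiction
      (λ { (two j) → ∣m∣n⇒∣m-n (even-coordinate {u} {two j} ∣-refl eu) (even-coordinate {v} {two j} ∣-refl ev) }) u≉v

  odds : (Fin k → Fin 2) → Index → ℤ
  odds e (two Fin.zero)    = 1ℤ
  odds e (two (Fin.suc j)) = + toℕ (e j)

  realizes : Realizes (1 ℕ.+ 2 ^ k)
  realizes = realizes-without-double
    where
    open Layered indices complete (λ _ → false) 2 (λ x → x (two Fin.zero)) (λ _ _ → refl) (λ _ _ x≋y → x≋y (two Fin.zero))
    determined : ∀ x y → (∀ ι → T false → + modulus ι ∣ x ι - y ι) →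
      (∀ ι → modulus ι ≡ 2 → + 2 ∣ x ι - y ι) → + 2 ∣ x (two Fin.zero) - y (two Fin.zero) → x ≋ y
    determined x y _ t _ (two j) = t (two j) refl
    open EvenModulus ∣-refl determined odds (λ _ _ ()) (λ _ → refl)
      (λ e e′ h j → toℕ-injective-mod-2 (e j) (e′ j) (h (two (Fin.suc j))))

module OnlyOdd (m1 : ℕ) (n : Fin (suc m1) → ℕ) (q : Fin 0 → ℕ) where

  open Coordinates (suc m1) 0 0 0 n q

  bound : Bound 2
  bound = bound-by-parity even? (λ _ _ → evens≤2) (λ _ _ _ odds _ → no-odds odds)
    where
    -- In a group of odd order every element is a double.
    no-odds : ∀ {us} → All (¬_ ∘ IsEven) us → length us ≤ 0
    no-odds [] = z≤n
    no-odds (u-odd ∷ _) = contradiction (even-from-halves λ { (odd i) → half-odd (n i) _ }) u-odd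

  ordinary : Index → Bool
  ordinary (odd Fin.zero) = false
  ordinary _              = true

  o : Index → ℤ
  o (odd Fin.zero) = 1ℤ
  o _              = 0ℤ

  realizes : 1 ≤ n Fin.zero → Realizes 2
  realizes 1≤n = realizes-pair determined o o≡0 refl
      λ M∣1 → 2k+1≢1 1≤n (ℕ.∣1⇒≡1 (∣⇒∣ᵤ M∣1))
    where
    open Layered indices complete ordinary (modulus (odd Fin.zero)) (λ x → x (odd Fin.zero)) (λ _ _ → refl)
      (λ _ _ x≋y → x≋y (odd Fin.zero))
    o≡0 : ∀ ι → T (ordinary ι) → o ι ≡ 0ℤ
    o≡0 (odd (Fin.suc _)) _ = refl
    determined : ∀ x y → (∀ ι → T (ordinary ι) → + modulus ι ∣ x ι - y ι) →
      + modulus (odd Fin.zero) ∣ x (odd Fin.zero) - y (odd Fin.zero) → x ≋ y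
    determined x y d z (odd Fin.zero)    = z
    determined x y d z (odd (Fin.suc i)) = d (odd (Fin.suc i)) _

theorem2p6 : (m1 m2 m3 r : ℕ) (n : Fin m1 → ℕ) (q : Fin m3 → ℕ)
    → (∀ i → 1 ≤ n i) → (∀ i → 1 ≤ q i)
    → ¬ (m1 ≡ 0 × m2 ≡ 0 × m3 ≡ 0 × r ≡ 0)
    → Group.IsMaxAvoidableEvenSize m1 m2 m3 r n q (maxSize m1 m2 m3 r)
theorem2p6 m1 m2 (suc m3) r n q _ 1≤q _ = isMax (WithFour.realizes m1 m2 m3 r n q (1≤q Fin.zero)) bound-general
  where open Coordinates m1 m2 (suc m3) r n q
theorem2p6 m1 m2 zero (suc r) n q _ _ _ = isMax (WithFree.realizes m1 m2 0 r n q) bound-general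
  where open Coordinates m1 m2 0 (suc r) n q
-- The trivial group has no partition into two nonempty classes and is excluded by hypothesis.
theorem2p6 zero zero zero zero _ _ _ _ nontrivial = contradiction (refl , refl , refl , refl) nontrivial
theorem2p6 zero (suc k) zero zero n q _ _ _ = Coordinates.isMax 0 (suc k) 0 0 n q realizes bound
  where open OnlyTwos k n q
theorem2p6 (suc m1) zero zero zero n q 1≤n _ _ = Coordinates.isMax (suc m1) 0 0 0 n q (realizes (1≤n Fin.zero)) bound
  where open OnlyOdd m1 n q
theorem2p6 (suc m1) (suc k) zero zero n q 1≤n _ _ = Coordinates.isMax (suc m1) (suc k) 0 0 n q (realizes (1≤n Fin.zero)) bound
  where open OddTimesTwos m1 k n q
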